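{- Let $b,r\ge 1$ and let $S$ be a standard skew tableau with exactly $b$ rows, each containing exactly $r$ cells. Then $S$ stabilizes at $b$; that is, every entry of $[(b-1)m+1,bm]$ (where $m=br$) lies in the same row of $\mathrm{Rect}(S^{(b)})$ as in $S^{(b)}$.
   Context: Tableaux use English notation. A standard skew tableau $S$ of size $m$ is a filling of the cells of a skew shape $\lambda/\mu$ with $1,\dots,m$, each used once, increasing left to right along rows and top to bottom down columns. The row vector of $S$ lists the numbers of cells in its rows from top to bottom. $S+x$ denotes $S$ with $x$ added to every entry. $\mathrm{Rect}(S)$ is the rectification of $S$ by Schützenberger's jeu de taquin (perform inner slides until a straight shape is reached; the result is independent of choices), equivalently the Schensted row-insertion tableau of the reading word of $S$ (entries read left to right in each row, rows taken from the bottom row to the top row). For $S$ standard of size $m$ with weakly decreasing row vector and $k\ge1$, $S^{(k)}$ is the standard skew tableau whose $i$-th row (from the top) consists of the cells of the $i$-th row of $S$ followed immediately to their right by the $i$-th rows of $S+m, S+2m,\dots,S+(k-1)m$, in this order. $S$ stabilizes at $k$ if every entry in $[(k-1)m+1,km]$ lies in the same row (counted from the top) of $\mathrm{Rect}(S^{(k)})$ as it does in $S^{(k)}$. -}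

module Defs where

open import Data.Nat using (ℕ; zero; suc; _+_; _*_; _∸_; _≤_; _<_; _<ᵇ_)
open import Data.Bool using (if_then_else_)
open import Data.Maybe using (Maybe; just; nothing)
open import Data.Product using (_×_; _,_; proj₁; proj₂)
open import Data.List using (List; []; _∷_; [_]; map; concat; concatMap; reverse; foldl; length; sum; upTo; applyUpTo)
open import Data.List.Relation.Unary.Linked using (Linked)
open import Data.List.Relation.Binary.Permutation.Propositional using (_↭_)
open import Data.List.Membership.Propositional using (_∈_)

-- Skew tableaux (English notation).
-- A skew tableau with rows numbered 0,1,2,... from the top is a list of
-- rows; each row is a pair (μᵢ , entries) where μᵢ is the column index of
-- its first cell and 'entries' are read left to right.  Row i thus
-- occupies the columns μᵢ , … , λᵢ - 1 with λᵢ = μᵢ + length entries.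

Row : Set
Row = ℕ × List ℕ

SkewTableau : Set
SkewTableau = List Row

data At : List ℕ → ℕ → ℕ → Set where
  here  : ∀ {x xs} → At (x ∷ xs) zero x
  there : ∀ {x xs j v} → At xs j v → At (x ∷ xs) (suc j) v

RowAbove : Row → Row → Set
RowAbove (μ , xs) (μ' , ys) =
  (μ' ≤ μ) × (μ' + length ys ≤ μ + length xs) ×
  (∀ j x y → At ys j y → μ ≤ μ' + j → At xs ((μ' + j) ∸ μ) x → x < y)

entries : SkewTableau → List ℕ
entries S = concat (map proj₂ S)

size : SkewTableau → ℕ
size S = length (entries S)

record IsStandardSkew (S : SkewTableau) : Set where
  field
    shape-cols : Linked RowAbove S
    rows-incr  : ∀ {row} → row ∈ S → Linked _<_ (proj₂ row)
    standard   : entries S ↭ applyUpTo suc (size S)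

shift : ℕ → SkewTableau → SkewTableau
shift x = map (λ row → proj₁ row , map (_+ x) (proj₂ row))

power : ℕ → SkewTableau → SkewTableau
power k S = map (λ row → proj₁ row ,
                   concatMap (λ j → map (_+ (j * size S)) (proj₂ row)) (upTo k)) S

-- Straight-shape tableau: list of rows from the top.
Tableau : Set
Tableau = List (List ℕ)

insertRow : ℕ → List ℕ → Maybe ℕ × List ℕ
insertRow x [] = nothing , [ x ]
insertRow x (y ∷ ys) with x <ᵇ y
... | Data.Bool.true  = just y , x ∷ ys
... | Data.Bool.false with insertRow x ys
...   | (b , ys') = b , y ∷ ys'

insert : ℕ → Tableau → Tableau
insert x [] = [ x ] ∷ []
insert x (row ∷ rows) with insertRow x row
... | (nothing , row') = row' ∷ rows
... | (just y  , row') = row' ∷ insert y rows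

insertionTableau : List ℕ → Tableau
insertionTableau = foldl (λ T x → insert x T) []

readingWord : SkewTableau → List ℕ
readingWord S = concat (reverse (map proj₂ S))

Rect : SkewTableau → Tableau
Rect S = insertionTableau (readingWord S)

data InRow : Tableau → ℕ → ℕ → Set where
  here  : ∀ {row rows e} → e ∈ row → InRow (row ∷ rows) zero e
  there : ∀ {row rows i e} → InRow rows i e → InRow (row ∷ rows) (suc i) e

StabilizesAt : SkewTableau → ℕ → Set
StabilizesAt S k =
  ∀ e → (k ∸ 1) * size S + 1 ≤ e → e ≤ k * size S →
  ∀ i → InRow (map proj₂ (power k S)) i e → InRow (Rect (power k S)) i e

{-# OPTIONS --safe #-}
module Submission where

-- Consecutive rows A (lower) and B (upper) of S have the same length, so the
-- excess #{a ∈ A : a ≤ t} − #{b ∈ B : b ≤ t} of their periodic continuations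
-- is periodic in t with period m.  Call T a cut if this excess is maximal
-- at T: past a cut, when (what is left of) B is row-inserted into (what is
-- left of) A, every entry of A is bumped.  Cuts recur with period m, so going
-- up from the bottom row, where we put the cut at 0, each pair of consecutive
-- rows can be given a cut lying at most m after the previous one.  The rows of
-- S^(k) are then inserted from the bottom up; after each row insertion, row p of
-- the tableau agrees with row p of the inserted part of S^(k) past (its cut) + p m.
-- With b rows all these bounds are at most (b − 1) m.

open import Defs
open import Data.Nat using (ℕ; _≤_; _*_)
open import Data.Product using (proj₂)
open import Data.List using (length)
open import Data.List.Relation.Unary.All using (All)
open import Relation.Binary.PropositionalEquality using (_≡_)

open import Data.Nat using (zero; suc; _+_; _∸_; _<_; z≤n; s≤s; _<?_; _≤?_; _<ᵇ_)
open import Data.Nat.Properties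
open import Algebra.Properties.CommutativeSemigroup +-commutativeSemigroup
  using (x∙yz≈y∙xz; interchange)
open import Data.Bool using (true; false; T)
open import Data.Empty using (⊥-elim)
open import Data.Maybe using (just; nothing)
open import Data.Product using (_×_; _,_; proj₁; ∃-syntax)
open import Data.Sum using (inj₁; inj₂)
open import Data.List using
  (List; []; _∷_; _++_; map; concat; concatMap; filter; foldl; foldr; reverse; upTo; applyUpTo)
open import Data.List.Properties using
  (length-++; length-map; filter-++; filter-accept; filter-reject; filter-all; filter-none;
   foldl-++; reverse-foldl; concatMap-cong; map-concatMap; map-id; map-cong; map-∘; map-upTo)
open import Data.List.Membership.Propositional using (_∈_)
open import Data.List.Membership.Propositional.Properties using
  (∈-++⁻; ∈-++⁺ˡ; ∈-++⁺ʳ; ∈-map⁻; ∈-filter⁺; ∈-filter⁻)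
open import Data.List.Relation.Binary.Disjoint.Propositional using (Disjoint)
open import Data.List.Relation.Binary.Permutation.Propositional using (↭-sym; ↭⇒↭ₛ)
open import Data.List.Relation.Binary.Permutation.Propositional.Properties
  using (All-resp-↭)
import Data.List.Relation.Binary.Permutation.Setoid.Properties as Permₛ
open import Data.List.Relation.Unary.All as All using ([]; _∷_)
import Data.List.Relation.Unary.All.Properties as All
open import Data.List.Relation.Unary.AllPairs as AllPairs using (AllPairs; []; _∷_)
import Data.List.Relation.Unary.AllPairs.Properties as AllPairs
open import Data.List.Relation.Unary.Any using (here; there)
open import Data.List.Relation.Unary.Linked.Properties using (Linked⇒AllPairs)
open import Data.List.Relation.Unary.Unique.Propositional using (Unique)
open import Data.List.Relation.Unary.Unique.Propositional.Properties using (applyUpTo⁺₁)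
open import Function using (_∘_; flip)
open import Relation.Binary.PropositionalEquality
  using (refl; setoid; sym; trans; cong; cong₂; subst; subst₂; module ≡-Reasoning)
open import Relation.Nullary using (¬_; yes; no)

Sorted : List ℕ → Set
Sorted = AllPairs _≤_

-- Inserting a sorted row into a tableau

insertAll : Tableau → List ℕ → Tableau
insertAll = foldl (λ T x → insert x T)

top : Tableau → List ℕ
top []      = []
top (X ∷ _) = X

below : Tableau → Tableau
below []       = []
below (_ ∷ Xs) = Xs

consTop : ℕ → Tableau → Tableau
consTop x Tab = (x ∷ top Tab) ∷ below Tab

-- The effect on a row `X` of inserting a whole sorted row `Y`, computed in one merge-like pass:
-- `kept` is the resulting row, `bumped` lists the displaced entries in the order in which they move
-- down.
kept bumped : List ℕ → List ℕ → List ℕ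
kept []      Y  = Y
kept (x ∷ X) [] = x ∷ X
kept (x ∷ X) (y ∷ Y) with y <? x
... | yes _ = y ∷ kept X Y
... | no  _ = x ∷ kept X (y ∷ Y)
bumped []      Y  = []
bumped (x ∷ X) [] = []
bumped (x ∷ X) (y ∷ Y) with y <? x
... | yes _ = x ∷ bumped X Y
... | no  _ = bumped X (y ∷ Y)

insert-bump : ∀ {x y} X Xs → y < x →
  insert y ((x ∷ X) ∷ Xs) ≡ (y ∷ X) ∷ insert x Xs
insert-bump {x} {y} X Xs y<x with y <ᵇ x in eq
... | true  = refl
... | false = ⊥-elim (subst T eq (<⇒<ᵇ y<x))

insert-consTop : ∀ {x y} Tab → x ≤ y → insert y (consTop x Tab) ≡ consTop x (insert y Tab)
insert-consTop {x} {y} Tab x≤y with y <ᵇ x in eq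
... | true = ⊥-elim (≤⇒≯ x≤y (<ᵇ⇒< y x (subst T (sym eq) _)))
insert-consTop []       x≤y | false = refl
insert-consTop {y = y} (X ∷ Xs) x≤y | false with insertRow y X
... | nothing , _ = refl
... | just _  , _ = refl

insertAll-consTop : ∀ {x} Tab {Y} → All (x ≤_) Y →
  insertAll (consTop x Tab) Y ≡ consTop x (insertAll Tab Y)
insertAll-consTop Tab [] = refl
insertAll-consTop Tab {y ∷ Y} (x≤y ∷ x≤Y) rewrite insert-consTop Tab x≤y =
  insertAll-consTop (insert y Tab) x≤Y

insertAll-[] : ∀ Xs {Y} → Sorted Y → insertAll ([] ∷ Xs) Y ≡ Y ∷ Xs
insertAll-[] Xs []         = refl
insertAll-[] Xs (y≤Y ∷ sY)
  rewrite insertAll-consTop ([] ∷ Xs) y≤Y | insertAll-[] Xs sY = refl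

-- As `Y` is sorted, a leading entry that is at most the next inserted one is never displaced later,
-- and `insertAll-consTop` splits it off. What happens in the first row does not depend on the rows
-- beneath, so the bumped entries may be passed down afterwards.
insertAll-∷ : ∀ X Xs {Y} → Sorted Y →
  insertAll (X ∷ Xs) Y ≡ kept X Y ∷ insertAll Xs (bumped X Y)
insertAll-∷ []      Xs sY          = insertAll-[] Xs sY
insertAll-∷ (x ∷ X) Xs []          = refl
insertAll-∷ (x ∷ X) Xs {y ∷ Y} (y≤Y ∷ sY) with y <? x
... | yes y<x
  rewrite insert-bump X Xs y<x
        | insertAll-consTop (X ∷ insert x Xs) y≤Y
        | insertAll-∷ X (insert x Xs) sY = refl
... | no y≮x
  rewrite insertAll-consTop (X ∷ Xs) (≮⇒≥ y≮x ∷ All.map (≤-trans (≮⇒≥ y≮x)) y≤Y)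
        | insertAll-∷ X Xs (y≤Y ∷ sY) = refl

insertAll-top : ∀ Tab {Y} → Sorted Y → top (insertAll Tab Y) ≡ kept (top Tab) Y
insertAll-top []       []         = refl
insertAll-top []       (y≤Y ∷ sY) = cong top (insertAll-∷ [] [] (y≤Y ∷ sY))
insertAll-top (X ∷ Xs) sY         = cong top (insertAll-∷ X Xs sY)

insertAll-below : ∀ Tab {Y} → Sorted Y →
  below (insertAll Tab Y) ≡ insertAll (below Tab) (bumped (top Tab) Y)
insertAll-below []       []         = refl
insertAll-below []       (y≤Y ∷ sY) = cong below (insertAll-∷ [] [] (y≤Y ∷ sY))
insertAll-below (X ∷ Xs) sY         = cong below (insertAll-∷ X Xs sY)

kept-All : ∀ {P : ℕ → Set} {X Y} → All P X → All P Y → All P (kept X Y)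
kept-All []         pY = pY
kept-All (px ∷ pX) []  = px ∷ pX
kept-All {X = x ∷ _} {y ∷ _} (px ∷ pX) (py ∷ pY) with y <? x
... | yes _ = py ∷ kept-All pX pY
... | no  _ = px ∷ kept-All pX (py ∷ pY)

bumped-All : ∀ {P : ℕ → Set} {X} Y → All P X → All P (bumped X Y)
bumped-All Y  []        = []
bumped-All [] (px ∷ pX) = []
bumped-All {X = x ∷ _} (y ∷ Y) (px ∷ pX) with y <? x
... | yes _ = px ∷ bumped-All Y pX
... | no  _ = bumped-All (y ∷ Y) pX

kept-sorted : ∀ {X Y} → Sorted X → Sorted Y → Sorted (kept X Y)
kept-sorted []         sY = sY
kept-sorted (x≤X ∷ sX) [] = x≤X ∷ sX
kept-sorted {x ∷ _} {y ∷ _} (x≤X ∷ sX) (y≤Y ∷ sY) with y <? x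
... | yes y<x = kept-All (All.map (≤-trans (<⇒≤ y<x)) x≤X) y≤Y ∷ kept-sorted sX sY
... | no  y≮x =
  kept-All x≤X (≮⇒≥ y≮x ∷ All.map (≤-trans (≮⇒≥ y≮x)) y≤Y) ∷ kept-sorted sX (y≤Y ∷ sY)

bumped-sorted : ∀ {X} Y → Sorted X → Sorted (bumped X Y)
bumped-sorted Y  []       = []
bumped-sorted [] (_ ∷ _)  = []
bumped-sorted {x ∷ _} (y ∷ Y) (x≤X ∷ sX) with y <? x
... | yes _ = bumped-All Y x≤X ∷ bumped-sorted Y sX
... | no  _ = bumped-sorted (y ∷ Y) sX

-- Entries above a threshold

above : ℕ → List ℕ → List ℕ
above t = filter (t <?_)

above-accept : ∀ {t x L} → t < x → above t (x ∷ L) ≡ x ∷ above t L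
above-accept {t} = filter-accept (t <?_)

above-reject : ∀ {t x L} → ¬ t < x → above t (x ∷ L) ≡ above t L
above-reject {t} = filter-reject (t <?_)

above-above : ∀ {s t} → s ≤ t → ∀ L → above t (above s L) ≡ above t L
above-above s≤t [] = refl
above-above {s} {t} s≤t (x ∷ L) with s <? x | t <? x
... | yes s<x | yes t<x
  rewrite above-accept {L = L} s<x | above-accept {L = L} t<x | above-accept {L = above s L} t<x =
  cong (x ∷_) (above-above s≤t L)
... | yes s<x | no t≮x
  rewrite above-accept {L = L} s<x | above-reject {L = L} t≮x | above-reject {L = above s L} t≮x =
  above-above s≤t L
... | no s≮x | yes t<x = ⊥-elim (s≮x (≤-<-trans s≤t t<x))
... | no s≮x | no t≮x
  rewrite above-reject {L = L} s≮x | above-reject {L = L} t≮x = above-above s≤t L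

above-mono : ∀ {s t} → s ≤ t → ∀ X Y → above s X ≡ above s Y → above t X ≡ above t Y
above-mono {t = t} s≤t X Y eq =
  trans (sym (above-above s≤t X)) (trans (cong (above t) eq) (above-above s≤t Y))

above-shift : ∀ m t L → above (t + m) (map (_+ m) L) ≡ map (_+ m) (above t L)
above-shift m t [] = refl
above-shift m t (x ∷ L) with t <? x
... | yes t<x
  rewrite above-accept {L = L} t<x | above-accept {L = map (_+ m) L} (+-monoˡ-< m t<x) =
  cong (x + m ∷_) (above-shift m t L)
... | no t≮x
  rewrite above-reject {L = L} t≮x
        | above-reject {L = map (_+ m) L} (t≮x ∘ +-cancelʳ-< m t x) =
  above-shift m t L

above-none : ∀ {t L} → All (_≤ t) L → above t L ≡ []
above-none {t} = filter-none (t <?_) ∘ All.map ≤⇒≯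

-- Termwise domination and bumping

data Dominated : List ℕ → List ℕ → Set where
  []  : ∀ {B} → Dominated B []
  _∷_ : ∀ {b a B A} → b < a → Dominated B A → Dominated (b ∷ B) (a ∷ A)

Dominated-drop : ∀ {B a A} → Sorted (a ∷ A) → Dominated B (a ∷ A) → Dominated B A
Dominated-drop {A = []}    _ _ = []
Dominated-drop {A = _ ∷ _} ((a≤a' ∷ _) ∷ sA) (b<a ∷ d) = <-≤-trans b<a a≤a' ∷ Dominated-drop sA d

Dominated-shift : ∀ m {B A} → Dominated B A → Dominated (map (_+ m) B) (map (_+ m) A)
Dominated-shift m []        = []
Dominated-shift m (b<a ∷ d) = +-monoˡ-< m b<a ∷ Dominated-shift m d

-- Both lists are traversed while the parts above `t` stay dominated. When a `y` at most `t` bumps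
-- an `x` above `t`, only `X` loses an entry above `t`, and `Dominated-drop` applies. No `x` above
-- `t` is kept: the head of `Y` would be its partner, hence smaller.
above-kept-bumped : ∀ t {X Y} → Sorted X → Sorted Y → Dominated (above t Y) (above t X) →
  above t (kept X Y) ≡ above t Y × above t (bumped X Y) ≡ above t X
above-kept-bumped t [] sY d = refl , refl
above-kept-bumped t {X} (_ ∷ _) [] d with above t X | d
... | [] | [] = refl , refl
above-kept-bumped t {x ∷ X} {y ∷ Y} (x≤X ∷ sX) (y≤Y ∷ sY) d with y <? x
above-kept-bumped t {x ∷ X} {y ∷ Y} (x≤X ∷ sX) (y≤Y ∷ sY) d | yes y<x with t <? y | t <? x
... | yes t<y | no t≮x = ⊥-elim (t≮x (<-trans t<y y<x))
... | yes t<y | yes t<x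
  rewrite above-accept {L = X} t<x | above-accept {L = Y} t<y
        | above-accept {L = kept X Y} t<y | above-accept {L = bumped X Y} t<x
  with _ ∷ d' ← d =
  let p , q = above-kept-bumped t sX sY d' in cong (y ∷_) p , cong (x ∷_) q
... | no t≮y | yes t<x
  rewrite above-accept {L = X} t<x | above-reject {L = Y} t≮y
        | above-reject {L = kept X Y} t≮y | above-accept {L = bumped X Y} t<x =
  let sx = All.filter⁺ (t <?_) x≤X ∷ AllPairs.filter⁺ (t <?_) sX
      p , q = above-kept-bumped t sX sY (Dominated-drop sx d)
  in p , cong (x ∷_) q
... | no t≮y | no t≮x
  rewrite above-reject {L = X} t≮x | above-reject {L = Y} t≮y
        | above-reject {L = kept X Y} t≮y | above-reject {L = bumped X Y} t≮x =
  above-kept-bumped t sX sY d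
above-kept-bumped t {x ∷ X} {y ∷ Y} (x≤X ∷ sX) (y≤Y ∷ sY) d | no y≮x with t <? x
... | yes t<x
  rewrite above-accept {L = X} t<x | above-accept {L = Y} (<-≤-trans t<x (≮⇒≥ y≮x))
  with y<x ∷ _ ← d = ⊥-elim (y≮x y<x)
... | no t≮x
  rewrite above-reject {L = X} t≮x | above-reject {L = kept X (y ∷ Y)} t≮x =
  above-kept-bumped t sX (y≤Y ∷ sY) d

-- Counting entries

count : ℕ → List ℕ → ℕ
count t L = length (filter (_≤? t) L)

count-accept : ∀ {t x} L → x ≤ t → count t (x ∷ L) ≡ suc (count t L)
count-accept {t} L = cong length ∘ filter-accept (_≤? t)

count-reject : ∀ {t x} L → ¬ x ≤ t → count t (x ∷ L) ≡ count t L
count-reject {t} L = cong length ∘ filter-reject (_≤? t)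

count-++ : ∀ t L L' → count t (L ++ L') ≡ count t L + count t L'
count-++ t L L' = trans (cong length (filter-++ (_≤? t) L L')) (length-++ (filter (_≤? t) L))

count-all : ∀ {t L} → All (_≤ t) L → count t L ≡ length L
count-all {t} = cong length ∘ filter-all (_≤? t)

count-zero : ∀ {L} → All (0 <_) L → count 0 L ≡ 0
count-zero = cong length ∘ filter-none (_≤? 0) ∘ All.map <⇒≱

-- Positivity makes the truncated subtraction harmless: for `t ≤ m` both sides are 0.
count-shift : ∀ m t {L} → All (0 <_) L → count t (map (_+ m) L) ≡ count (t ∸ m) L
count-shift m t [] = refl
count-shift m t {x ∷ L} (0<x ∷ 0<L) with x ≤? t ∸ m
... | yes x≤t∸m
  rewrite count-accept L x≤t∸m
        | count-accept (map (_+ m) L)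
            (m≤o∸n⇒m+n≤o x {m} {t} (<⇒≤ (m∸n≢0⇒n<m {t} {m} (>⇒≢ (<-≤-trans 0<x x≤t∸m)))) x≤t∸m) =
  cong suc (count-shift m t 0<L)
... | no x≰t∸m
  rewrite count-reject L x≰t∸m
        | count-reject (map (_+ m) L) (x≰t∸m ∘ m+n≤o⇒m≤o∸n x {m} {t}) =
  count-shift m t 0<L

count-above : ∀ {s t} → s ≤ t → ∀ L → count t (above s L) + count s L ≡ count t L
count-above s≤t [] = refl
count-above {s} {t} s≤t (x ∷ L) with s <? x
... | no s≮x
  rewrite above-reject {L = L} s≮x | count-accept L (≮⇒≥ s≮x)
        | count-accept L (≤-trans (≮⇒≥ s≮x) s≤t)
        | +-suc (count t (above s L)) (count s L) = cong suc (count-above s≤t L)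
... | yes s<x with x ≤? t
...   | yes x≤t
  rewrite above-accept {L = L} s<x | count-reject L (<⇒≱ s<x) | count-accept L x≤t
        | count-accept (above s L) x≤t = cong suc (count-above s≤t L)
...   | no x≰t
  rewrite above-accept {L = L} s<x | count-reject L (<⇒≱ s<x) | count-reject L x≰t
        | count-reject (above s L) x≰t = count-above s≤t L

-- If `a` is the `i`-th entry of `A`, then at least `i` entries of `A`, hence of `B`, are at most
-- `a`, so the `i`-th entry of `B` is one of them. Disjointness makes the inequality strict.
count⇒Dominated : ∀ {B A} → Sorted B → Sorted A → Disjoint A B →
  (∀ {t} → t ∈ A → count t A ≤ count t B) → Dominated B A
count⇒Dominated sB [] dis le = []
count⇒Dominated {[]} {a ∷ A} sB (a≤A ∷ sA) dis le
  with () ← subst (_≤ 0) (count-accept {a} A ≤-refl) (le {a} (here refl))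
count⇒Dominated {b ∷ B} {a ∷ A} (b≤B ∷ sB) (a≤A ∷ sA) dis le with b ≤? a
... | no b≰a
  with () ← subst₂ _≤_ (count-accept {a} A ≤-refl)
              (cong length (filter-none (_≤? a)
                 (b≰a ∷ All.map (λ b≤x x≤a → b≰a (≤-trans b≤x x≤a)) b≤B)))
              (le {a} (here refl))
... | yes b≤a =
  ≤∧≢⇒< b≤a (λ { refl → dis (here refl , here refl) })
  ∷ count⇒Dominated sB sA (λ (p , q) → dis (there p , there q)) λ t∈A →
      let a≤t = All.lookup a≤A t∈A in
      ≤-pred (subst₂ _≤_ (count-accept A a≤t) (count-accept B (≤-trans b≤a a≤t)) (le (there t∈A)))

-- The difference of `f` and `g` is maximal at `s`; sums replace it because subtraction truncates.
excess-maximum : ∀ (f g : ℕ → ℕ) n → ∃[ s ] s ≤ n × (∀ {t} → t ≤ n → f t + g s ≤ f s + g t)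
excess-maximum f g zero = 0 , z≤n , λ { z≤n → ≤-refl }
excess-maximum f g (suc n) with excess-maximum f g n
... | s , s≤n , max with f (suc n) + g s ≤? f s + g (suc n)
...   | yes le = s , m≤n⇒m≤1+n s≤n , λ t≤ → case (m≤n⇒m<n∨m≡n t≤)
  where
  case : ∀ {t} → _ → f t + g s ≤ f s + g t
  case (inj₁ t<) = max (≤-pred t<)
  case (inj₂ refl) = le
...   | no ≰ = suc n , ≤-refl , λ t≤ → case (m≤n⇒m<n∨m≡n t≤)
  where
  case : ∀ {t} → _ → f t + g (suc n) ≤ f (suc n) + g t
  case (inj₂ refl) = ≤-refl
  -- With `f s + g s` added to both sides, the claim is the sum of the two known comparisons with
  -- `s`.
  case {t} (inj₁ t<) = +-cancelʳ-≤ (f s + g s) _ _ (begin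
    (f t + g (suc n)) + (f s + g s) ≡⟨ cong (f t + g (suc n) +_) (+-comm (f s) (g s)) ⟩
    (f t + g (suc n)) + (g s + f s) ≡⟨ interchange (f t) _ (g s) _ ⟩
    (f t + g s) + (g (suc n) + f s) ≤⟨ +-mono-≤ (max (≤-pred t<))
         (subst (_≤ f (suc n) + g s) (+-comm (f s) _) (≰⇒≥ ≰)) ⟩
    (f s + g t) + (f (suc n) + g s) ≡⟨ cong (_+ (f (suc n) + g s)) (+-comm (f s) (g t)) ⟩
    (g t + f s) + (f (suc n) + g s) ≡⟨ interchange (g t) _ (f (suc n)) _ ⟩
    (g t + f (suc n)) + (f s + g s) ≡⟨ cong (_+ (f s + g s)) (+-comm (g t) _) ⟩
    (f (suc n) + g t) + (f s + g s) ∎)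
    where open ≤-Reasoning

-- Periodic continuations of rows and their cuts

module Periodic (m : ℕ) where

  InPeriod : List ℕ → Set
  InPeriod = All (λ x → 0 < x × x ≤ m)

  -- All later periods are shifted as one block, so that induction on `k` peels off the lowest
  -- period.
  copies : ℕ → List ℕ → List ℕ
  copies zero    Q = []
  copies (suc k) Q = Q ++ map (_+ m) (copies k Q)

  copies-positive : ∀ k {Q} → InPeriod Q → All (0 <_) (copies k Q)
  copies-positive zero    pQ = []
  copies-positive (suc k) pQ = All.++⁺ (All.map proj₁ pQ)
    (All.map⁺ (All.map (λ 0<x → ≤-trans 0<x (m≤m+n _ m)) (copies-positive k pQ)))

  shifted-above : ∀ k {Q} → InPeriod Q → All (m <_) (map (_+ m) (copies k Q))
  shifted-above k pQ = All.map⁺ (All.map (m<n+m m) (copies-positive k pQ))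

  copies-sorted : ∀ k {Q} → InPeriod Q → Sorted Q → Sorted (copies k Q)
  copies-sorted zero    pQ sQ = []
  copies-sorted (suc k) pQ sQ = AllPairs.++⁺ sQ
    (AllPairs.map⁺ (AllPairs.map (+-monoˡ-≤ m) (copies-sorted k pQ sQ)))
    (All.map (λ (_ , x≤m) → All.map (λ m<z → ≤-trans x≤m (<⇒≤ m<z)) (shifted-above k pQ)) pQ)

  copies-disjoint : ∀ k {A B} → InPeriod A → InPeriod B → Disjoint A B →
    Disjoint (copies k A) (copies k B)
  copies-disjoint zero pA pB dis (() , _)
  copies-disjoint (suc k) {A} {B} pA pB dis (e∈A , e∈B) with ∈-++⁻ A e∈A | ∈-++⁻ B e∈B
  ... | inj₁ p | inj₁ q = dis (p , q)
  ... | inj₁ p | inj₂ q = <⇒≱ (All.lookup (shifted-above k pB) q) (proj₂ (All.lookup pA p))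
  ... | inj₂ p | inj₁ q = <⇒≱ (All.lookup (shifted-above k pA) p) (proj₂ (All.lookup pB q))
  ... | inj₂ p | inj₂ q with ∈-map⁻ (_+ m) p | ∈-map⁻ (_+ m) q
  ...   | a , a∈ , refl | b , b∈ , eq =
    copies-disjoint k pA pB dis (a∈ , subst (_∈ copies k B) (sym (+-cancelʳ-≡ m a b eq)) b∈)

  count-copies : ∀ t k {Q} → InPeriod Q →
    count t (copies (suc k) Q) ≡ count t Q + count (t ∸ m) (copies k Q)
  count-copies t k {Q} pQ =
    trans (count-++ t Q _) (cong (count t Q +_) (count-shift m t (copies-positive k pQ)))

  count-copies-≤ : ∀ {t} → t ≤ m → ∀ k {Q} → InPeriod Q → count t (copies (suc k) Q) ≡ count t Q
  count-copies-≤ {t} t≤m k {Q} pQ rewrite count-copies t k pQ | m≤n⇒m∸n≡0 t≤m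
    | count-zero (copies-positive k pQ) = +-identityʳ _

  -- `B` is the upper row, inserted into the lower row `A`. A cut is encoded by its consequence for
  -- bumping, and at all `t + q * m` because row `q` of the tableau uses it `q` periods later.
  Cut : List ℕ → List ℕ → ℕ → Set
  Cut B A t = ∀ q k → Dominated (above (t + q * m) (copies k B)) (above (t + q * m) (copies k A))

  module _ {B A : List ℕ} (pB : InPeriod B) (pA : InPeriod A) where

    -- A full period adds the same length to both counts, so past the first period the excess at `t`
    -- is that at `t ∸ m` with one copy fewer.
    maximum⇒excess-copies : ∀ {s} → length B ≡ length A →
      (∀ {t} → t ≤ m → count t A + count s B ≤ count s A + count t B) →
      ∀ k t → count t (copies k A) + count s B ≤ count s A + count t (copies k B)
    -- Without copies the excess is 0, its value at threshold 0 because all entries are positive.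
    maximum⇒excess-copies {s} eq max zero t =
      subst₂ (λ u v → u + count s B ≤ count s A + v) (count-zero (All.map proj₁ pA)) (count-zero (All.map proj₁ pB))
        (max z≤n)
    maximum⇒excess-copies {s} eq max (suc k) t with ≤-total t m
    ... | inj₁ t≤m rewrite count-copies-≤ t≤m k pA | count-copies-≤ t≤m k pB = max t≤m
    ... | inj₂ m≤t
      rewrite count-copies t k pA | count-copies t k pB
            | count-all (All.map (λ (_ , x≤m) → ≤-trans x≤m m≤t) pA)
            | count-all (All.map (λ (_ , x≤m) → ≤-trans x≤m m≤t) pB) | eq = begin
        (length A + count (t ∸ m) (copies k A)) + count s B ≡⟨ +-assoc (length A) _ _ ⟩
        length A + (count (t ∸ m) (copies k A) + count s B)
          ≤⟨ +-monoʳ-≤ (length A) (maximum⇒excess-copies eq max k (t ∸ m)) ⟩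
        length A + (count s A + count (t ∸ m) (copies k B)) ≡⟨ x∙yz≈y∙xz (length A) (count s A) (count (t ∸ m) (copies k B)) ⟩
        count s A + (length A + count (t ∸ m) (copies k B)) ∎
      where open ≤-Reasoning

    -- Raising the threshold by `m` discards the first period; what remains is the shift of one copy
    -- fewer above `t`.
    Dominated-above-+ : ∀ {t} →
      (∀ k → Dominated (above t (copies k B)) (above t (copies k A))) →
      ∀ k → Dominated (above (t + m) (copies k B)) (above (t + m) (copies k A))
    Dominated-above-+ d zero = []
    Dominated-above-+ {t} d (suc k) =
      subst₂ Dominated (sym (lemma pB)) (sym (lemma pA)) (Dominated-shift m (d k))
      where
      lemma : ∀ {Q} → InPeriod Q →
        above (t + m) (copies (suc k) Q) ≡ map (_+ m) (above t (copies k Q))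
      lemma {Q} pQ = trans (filter-++ (t + m <?_) Q _)
        (cong₂ _++_ (above-none (All.map (λ (_ , x≤m) → ≤-trans x≤m (m≤n+m m t)) pQ))
                    (above-shift m t (copies k Q)))

    Dominated⇒Cut : ∀ {t} →
      (∀ k → Dominated (above t (copies k B)) (above t (copies k A))) → Cut B A t
    Dominated⇒Cut {t} d zero =
      subst (λ u → ∀ k → Dominated (above u (copies k B)) (above u (copies k A)))
        (sym (+-identityʳ t)) d
    Dominated⇒Cut {t} d (suc q) =
      subst (λ u → ∀ k → Dominated (above u (copies k B)) (above u (copies k A)))
        (+-assoc t m (q * m)) (Dominated⇒Cut (Dominated-above-+ d) q)

    -- At a maximum `s` of the excess of `A` over `B`, no later stretch starting at `s` contains
    -- more entries of `A` than of `B`, which is the criterion of `count⇒Dominated`.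
    cut-exists : Sorted B → Sorted A → Disjoint A B → length B ≡ length A →
      ∃[ s ] s ≤ m × Cut B A s
    cut-exists sB sA dis eq with excess-maximum (λ t → count t A) (λ t → count t B) m
    ... | s , s≤m , max = s , s≤m , Dominated⇒Cut dominated
      where
      dominated : ∀ k → Dominated (above s (copies k B)) (above s (copies k A))
      dominated zero = []
      dominated (suc k) = count⇒Dominated
        (AllPairs.filter⁺ (s <?_) (copies-sorted (suc k) pB sB))
        (AllPairs.filter⁺ (s <?_) (copies-sorted (suc k) pA sA))
        (λ (p , q) → copies-disjoint (suc k) pA pB dis
           (proj₁ (∈-filter⁻ (s <?_) p) , proj₁ (∈-filter⁻ (s <?_) {xs = copies (suc k) B} q)))
        λ {t} t∈ → let s≤t = <⇒≤ (proj₂ (∈-filter⁻ (s <?_) {xs = copies (suc k) A} t∈)) in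
          +-cancelʳ-≤ (count s A + count s B) _ _ (begin
            count t (above s (copies (suc k) A)) + (count s A + count s B)
              ≡⟨ sym (+-assoc (count t (above s (copies (suc k) A))) (count s A) (count s B)) ⟩
            (count t (above s (copies (suc k) A)) + count s A) + count s B
              ≡⟨ cong (_+ count s B) (split s≤t pA) ⟩
            count t (copies (suc k) A) + count s B
              ≤⟨ maximum⇒excess-copies eq max (suc k) t ⟩
            count s A + count t (copies (suc k) B)
              ≡⟨ cong (count s A +_) (sym (split s≤t pB)) ⟩
            count s A + (count t (above s (copies (suc k) B)) + count s B)
              ≡⟨ x∙yz≈y∙xz (count s A) (count t (above s (copies (suc k) B))) (count s B) ⟩
            count t (above s (copies (suc k) B)) + (count s A + count s B) ∎)
        where
        open ≤-Reasoning
        split : ∀ {t Q} → s ≤ t → InPeriod Q →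
          count t (above s (copies (suc k) Q)) + count s Q ≡ count t (copies (suc k) Q)
        -- As `s ≤ m`, only the first period contributes to the count up to `s`.
        split {t} {Q} s≤t pQ = trans
          (cong (count t (above s (copies (suc k) Q)) +_) (sym (count-copies-≤ s≤m k pQ)))
          (count-above s≤t (copies (suc k) Q))

  Cut-+ : ∀ {B A t} q → Cut B A t → Cut B A (t + q * m)
  Cut-+ {B} {A} {t} q cut q' =
    subst (λ u → ∀ k → Dominated (above u (copies k B)) (above u (copies k A)))
      (trans (cong (t +_) (*-distribʳ-+ m q q')) (sym (+-assoc t (q * m) (q' * m)))) (cut (q + q'))

  -- A compatible choice of cuts for all rows

  next-in-progression : 0 < m → ∀ {s} → s ≤ m → ∀ τ → ∃[ q ] τ ≤ s + q * m × s + q * m ≤ τ + m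
  next-in-progression 0<m {s} s≤m zero = 0 , z≤n , subst (_≤ m) (sym (+-identityʳ s)) s≤m
  next-in-progression 0<m {s} s≤m (suc τ) with next-in-progression 0<m s≤m τ
  ... | q , lo , hi with m≤n⇒m<n∨m≡n lo
  ...   | inj₁ τ< = q , τ< , m≤n⇒m≤1+n hi
  -- The old term is `τ` itself, so the next one, `τ + m`, is taken.
  ...   | inj₂ τ≡ = suc q , subst (suc τ ≤_) eq (m<m+n τ 0<m) , m≤n⇒m≤1+n (≤-reflexive (sym eq))
    where
    eq : τ + m ≡ s + suc q * m
    eq = trans (cong (_+ m) τ≡) (trans (+-assoc s (q * m) m) (cong (s +_) (+-comm (q * m) m)))

  -- Rows are listed from the top, each with a cut against the row beneath. The bottom row meets an
  -- empty tableau and gets 0.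
  data Cuts : List (ℕ × List ℕ) → Set where
    []   : Cuts []
    last : ∀ {Q} → Cuts ((0 , Q) ∷ [])
    step : ∀ {t s B A cs} → s ≤ t → t ≤ s + m → Cut B A t →
           Cuts ((s , A) ∷ cs) → Cuts ((t , B) ∷ (s , A) ∷ cs)

  Cuts-head-≤ : ∀ {t Q cs} → Cuts ((t , Q) ∷ cs) → t ≤ length cs * m
  Cuts-head-≤ last = z≤n
  Cuts-head-≤ {cs = (s , _) ∷ cs} (step _ t≤s+m _ c) = ≤-trans t≤s+m
    (subst (s + m ≤_) (+-comm (length cs * m) m) (+-monoˡ-≤ m (Cuts-head-≤ c)))

  cuts : 0 < m → ∀ {r rows} → All (λ Q → InPeriod Q × Sorted Q × length Q ≡ r) rows →
    AllPairs Disjoint rows → ∃[ cs ] map proj₂ cs ≡ rows × Cuts cs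
  cuts 0<m [] _ = [] , refl , []
  cuts 0<m {rows = Q ∷ []} (_ ∷ []) _ = (0 , Q) ∷ [] , refl , last
  cuts 0<m {rows = B ∷ A ∷ _} ((pB , sB , lB) ∷ props@((pA , sA , lA) ∷ _)) ((dis ∷ _) ∷ diss)
    with cuts 0<m props diss
  ... | (τ , A) ∷ cs , refl , c
    with cut-exists pB pA sB sA (λ (p , q) → dis (q , p)) (trans lB (sym lA))
  -- The cut from the first period moves up by whole periods into the window from `τ` to `τ + m`.
  ... | s , s≤m , cut with next-in-progression 0<m s≤m τ
  ... | q , lo , hi = (s + q * m , B) ∷ (τ , A) ∷ cs , refl , step lo hi (Cut-+ q cut) c

  -- Row insertion past the cuts

  module _ (k : ℕ) where

    -- `q` is the index, in the whole tableau, of the first row of `Tab`; each row further down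
    -- costs one more period.
    Agrees : ℕ → List (ℕ × List ℕ) → Tableau → Set
    Agrees q []             Tab = Tab ≡ []
    Agrees q ((t , Q) ∷ cs) Tab =
      Sorted (top Tab) × above (t + q * m) (top Tab) ≡ above (t + q * m) (copies k Q) ×
      Agrees (suc q) cs (below Tab)

    -- `Y` need only agree with the copies of `Q` past the threshold, so that the induction can
    -- insert the list bumped from one row into the next.
    insertAll-agrees : ∀ q {t Q cs} Tab {Y} → Cuts ((t , Q) ∷ cs) → Agrees q cs Tab →
      Sorted Y → above (t + q * m) Y ≡ above (t + q * m) (copies k Q) →
      Agrees q ((t , Q) ∷ cs) (insertAll Tab Y)
    insertAll-agrees q .[] last refl sY eq
      rewrite insertAll-top [] sY | insertAll-below [] sY = sY , eq , refl
    insertAll-agrees q {t} {B} Tab {Y} (step {s = s} {A = A} s≤t t≤s+m cut c) (sX , eqX , ag) sY eqY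
      rewrite insertAll-top Tab sY | insertAll-below Tab sY =
      kept-sorted sX sY , trans (proj₁ key) eqY ,
      insertAll-agrees (suc q) (below Tab) c ag (bumped-sorted Y sX)
        (above-mono next (bumped (top Tab) Y) (copies k A) (trans (proj₂ key) eqX'))
      where
      eqX' : above (t + q * m) (top Tab) ≡ above (t + q * m) (copies k A)
      -- Since `s ≤ t`, the old first row is already known past the threshold of the new cut.
      eqX' = above-mono (+-monoˡ-≤ (q * m) s≤t) (top Tab) (copies k A) eqX
      key = above-kept-bumped (t + q * m) sX sY (subst₂ Dominated (sym eqY) (sym eqX') (cut q k))
      next : t + q * m ≤ s + suc q * m
      -- Since `t ≤ s + m`, the bumped list is known past the threshold of `A` one row further down.
      next = ≤-trans (+-monoˡ-≤ (q * m) t≤s+m) (≤-reflexive (+-assoc s m (q * m)))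

    insertRows : List (List ℕ) → Tableau
    insertRows = foldr (flip insertAll) []

    insertRows-agrees : ∀ {cs} → Cuts cs → All (λ Q → InPeriod Q × Sorted Q) (map proj₂ cs) →
      Agrees 0 cs (insertRows (map (copies k) (map proj₂ cs)))
    insertRows-agrees [] [] = refl
    insertRows-agrees last ((pQ , sQ) ∷ []) =
      insertAll-agrees 0 [] last refl (copies-sorted k pQ sQ) refl
    insertRows-agrees {_ ∷ cs} c@(step _ _ _ c') ((pQ , sQ) ∷ props) =
      insertAll-agrees 0 (insertRows (map (copies k) (map proj₂ cs))) c
        (insertRows-agrees c' props) (copies-sorted k pQ sQ) refl

    top-∈ : ∀ {e} Tab → e ∈ top Tab → InRow Tab 0 e
    top-∈ (_ ∷ _) = here

    below-∈ : ∀ {i e} Tab → InRow (below Tab) i e → InRow Tab (suc i) e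
    below-∈ (_ ∷ _) = there

    Cuts-tail : ∀ {c cs} → Cuts (c ∷ cs) → Cuts cs
    Cuts-tail last           = []
    Cuts-tail (step _ _ _ c) = c

    -- The cut of a row is at most `m` times the number of rows beneath it, and its index `q` adds
    -- `q` periods. The sum of these two numbers is at most `n`, so `e` lies past every threshold.
    agrees⇒InRow : ∀ n q {cs} Tab {i e} → Cuts cs → Agrees q cs Tab →
      length cs + q ≤ suc n → n * m < e →
      InRow (map (copies k) (map proj₂ cs)) i e → InRow Tab i e
    agrees⇒InRow n q {(t , Q) ∷ cs} Tab c (_ , eq , _) (s≤s len) n< (here e∈) =
      top-∈ Tab (proj₁ (∈-filter⁻ (t + q * m <?_) {xs = top Tab}
        (subst (_ ∈_) (sym eq) (∈-filter⁺ (t + q * m <?_) e∈ bound))))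
      where
      bound : t + q * m < _
      bound = ≤-<-trans (≤-trans (+-monoˡ-≤ (q * m) (Cuts-head-≤ c))
        (≤-trans (≤-reflexive (sym (*-distribʳ-+ m (length cs) q))) (*-monoˡ-≤ m len))) n<
    agrees⇒InRow n q {_ ∷ cs} Tab c (_ , _ , ag) len n< (there e∈) =
      below-∈ Tab (agrees⇒InRow n (suc q) (below Tab) (Cuts-tail c) ag
        (subst (_≤ suc n) (sym (+-suc (length cs) q)) len) n< e∈)

  -- Comparison with `power` and `Rect`

  copies-concatMap : ∀ k Q → concatMap (λ j → map (_+ (j * m)) Q) (upTo k) ≡ copies k Q
  copies-concatMap zero    Q = refl
  copies-concatMap (suc k) Q = cong₂ _++_ (trans (map-cong +-identityʳ Q) (map-id Q)) (begin
    concatMap g (applyUpTo suc k)           ≡⟨ cong (concatMap g) (sym (map-upTo suc k)) ⟩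
    concatMap g (map suc (upTo k))          ≡⟨ cong concat (sym (map-∘ (upTo k))) ⟩
    concatMap (g ∘ suc) (upTo k)            ≡⟨ concatMap-cong shift-g (upTo k) ⟩
    concatMap (map (_+ m) ∘ g) (upTo k)     ≡⟨ sym (map-concatMap (_+ m) g (upTo k)) ⟩
    map (_+ m) (concatMap g (upTo k))       ≡⟨ cong (map (_+ m)) (copies-concatMap k Q) ⟩
    map (_+ m) (copies k Q)                 ∎)
    where
    open ≡-Reasoning
    g : ℕ → List ℕ
    g j = map (_+ (j * m)) Q
    shift-g : ∀ j → g (suc j) ≡ map (_+ m) (g j)
    shift-g j = trans
      (map-cong (λ x → trans (cong (x +_) (+-comm m (j * m))) (sym (+-assoc x (j * m) m))) Q)
      (map-∘ Q)

open Periodic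

foldl-concat : ∀ {A B : Set} (f : A → B → A) a xss → foldl f a (concat xss) ≡ foldl (foldl f) a xss
foldl-concat f a []         = refl
foldl-concat f a (xs ∷ xss) =
  trans (foldl-++ f a xs (concat xss)) (foldl-concat f (foldl f a xs) xss)

-- The reading word starts with the bottom row, and a right fold over the rows from the top inserts
-- that row first.
Rect-insertAll : ∀ S → Rect S ≡ foldr (flip insertAll) [] (map proj₂ S)
Rect-insertAll S = trans (foldl-concat _ [] (reverse (map proj₂ S)))
  (reverse-foldl insertAll [] (map proj₂ S))

power-rows : ∀ k S → map proj₂ (power k S) ≡ map (copies (size S) k) (map proj₂ S)
power-rows k S = trans (sym (map-∘ S))
  (trans (map-cong (λ row → copies-concatMap (size S) k (proj₂ row)) S) (map-∘ S))

-- Disjointness of the rows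

Unique-++⇒Disjoint : ∀ {A : Set} (xs : List A) {ys} → Unique (xs ++ ys) → Disjoint xs ys
Unique-++⇒Disjoint (x ∷ xs) (x∉ ∷ _) (here refl , q) = All.lookup (All.++⁻ʳ xs x∉) q refl
Unique-++⇒Disjoint (x ∷ xs) (_ ∷ u)  (there p , q)   = Unique-++⇒Disjoint xs u (p , q)

Unique-++⁻ʳ : ∀ {A : Set} (xs : List A) {ys} → Unique (xs ++ ys) → Unique ys
Unique-++⁻ʳ []       u       = u
Unique-++⁻ʳ (x ∷ xs) (_ ∷ u) = Unique-++⁻ʳ xs u

Disjoint-concat : ∀ {A : Set} {xs : List A} xss → Disjoint xs (concat xss) → All (Disjoint xs) xss
Disjoint-concat []         dis = []
Disjoint-concat (ys ∷ xss) dis =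
  (λ (p , q) → dis (p , ∈-++⁺ˡ q)) ∷ Disjoint-concat xss (λ (p , q) → dis (p , ∈-++⁺ʳ ys q))

Unique-concat⇒Disjoint : ∀ {A : Set} (xss : List (List A)) →
  Unique (concat xss) → AllPairs Disjoint xss
Unique-concat⇒Disjoint []         u = []
Unique-concat⇒Disjoint (xs ∷ xss) u =
  Disjoint-concat xss (Unique-++⇒Disjoint xs u) ∷ Unique-concat⇒Disjoint xss (Unique-++⁻ʳ xs u)

theorem1p4 : (b r : ℕ) → 1 ≤ b → 1 ≤ r → (S : SkewTableau) →
    IsStandardSkew S → length S ≡ b →
    All (λ row → length (proj₂ row) ≡ r) S →
    StabilizesAt S b
theorem1p4 (suc n) r _ _ S std len lens e lo hi i e∈ =
  subst (λ Tab → InRow Tab i e) (sym (Rect-insertAll (power (suc n) S)))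
  (subst (λ rows → InRow (insertRows (size S) (suc n) rows) i e) rows≡
    (agrees⇒InRow (size S) (suc n) n 0 _ c
      (insertRows-agrees (size S) (suc n) c (subst (All _) (sym eq) (All.zip (inPeriod , sorted))))
      (≤-reflexive length≡) (subst (_≤ e) (+-comm (n * size S) 1) lo)
      (subst (λ rows → InRow rows i e) (sym rows≡) e∈)))
  where
  open IsStandardSkew std
  rows = map proj₂ S
  0<m : 0 < size S
  0<m with size S
  ... | suc _ = s≤s z≤n
  -- With size 0 the bounds on `e` would give `1 ≤ 0`.
  ... | zero with () ← subst₂ _≤_ (+-comm (n * 0) 1) (*-zeroʳ n) (≤-trans lo hi)
  inPeriod : All (InPeriod (size S)) rows
  inPeriod = All.concat⁻ (All-resp-↭ (↭-sym standard)
    (All.applyUpTo⁺₁ suc (size S) (λ j<m → s≤s z≤n , j<m)))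
  sorted : All Sorted rows
  sorted = All.map⁺ (All.tabulate λ row∈S →
    AllPairs.map <⇒≤ (Linked⇒AllPairs <-trans (rows-incr row∈S)))
  disjoint : AllPairs Disjoint rows
  disjoint = Unique-concat⇒Disjoint rows (Permₛ.Unique-resp-↭ (setoid ℕ) (↭⇒↭ₛ (↭-sym standard))
    (applyUpTo⁺₁ suc (size S) (λ i<j _ → <⇒≢ i<j ∘ suc-injective)))
  cutting = cuts (size S) 0<m (All.zip (inPeriod , All.zip (sorted , All.map⁺ lens))) disjoint
  cs = proj₁ cutting
  eq = proj₁ (proj₂ cutting)
  c  = proj₂ (proj₂ cutting)
  rows≡ : map (copies (size S) (suc n)) (map proj₂ cs) ≡ map proj₂ (power (suc n) S)
  rows≡ = trans (cong (map (copies (size S) (suc n))) eq) (sym (power-rows (suc n) S))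
  length≡ : length cs + 0 ≡ suc n
  length≡ = trans (+-identityʳ _) (trans (sym (length-map proj₂ cs))
    (trans (cong length eq) (trans (length-map proj₂ S) len)))
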